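{- Let $U,V$ be finite sets and let $\rho$ be a probability distribution on $U\times V$ that is not a product distribution (i.e. $\rho\neq\rho_U\otimes\rho_V$, where $\rho_U,\rho_V$ are the marginals of $\rho$). For $n\in\mathbb{N}$ let $\mathit{EQ}_n\colon\{0,1\}^n\times\{0,1\}^n\to\{0,1\}$ be the equality function, $\mathit{EQ}_n(x,y)=1$ if $x=y$ and $\mathit{EQ}_n(x,y)=0$ otherwise. Then $\mathit{SMP}_\rho(\mathit{EQ}_n)=O(1)$, where the implied constant depends only on $\rho$ and not on $n$; that is, there is a constant $C_\rho$ with $\mathit{SMP}_\rho(\mathit{EQ}_n)\le C_\rho$ for all $n$.
   Context: SMP model with source $\rho$. A protocol for a function $f$ on $\{0,1\}^n\times\{0,1\}^n$ fixes a number $\ell\in\mathbb{N}$ of independent samples $(u_1,v_1),\dots,(u_\ell,v_\ell)\sim\rho$. Alice receives her input $x$ and $(u_1,\dots,u_\ell)$; Bob receives his input $y$ and $(v_1,\dots,v_\ell)$. Each of them sends a single message, depending only on what they received, to a referee, who sees only the two messages and outputs an answer. (Players and referee may also use private independent randomness.) The protocol has error probability $\delta$ if for every input $(x,y)$ in the domain of $f$ the answer equals $f(x,y)$ with probability at least $1-\delta$. The cost of the protocol is the maximum possible total number of bits sent by Alice and Bob. $\mathit{SMP}_\rho(f)$ is the minimum cost of a protocol with source $\rho$ that solves $f$ with error probability less than $1/3$. -}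

module Defs where

open import Algebra.Apartness.Bundles using (HeytingCommutativeRing; HeytingField)
open import Algebra.Bundles using (CommutativeRing)
import Algebra.Definitions.RawMonoid as RawMonoidDefs
open import Data.Bool.Base using (Bool; true; false; if_then_else_)
import Data.Bool.Properties as Bool
open import Data.Fin.Base using (Fin)
open import Data.Fin.Properties using (any?)
open import Data.List.Base using (List; length)
open import Data.Nat.Base as ℕ using (ℕ; zero; suc; _⊔_)
open import Data.Product.Base using (∃; ∃-syntax; _×_; _,_; proj₁; proj₂)
open import Data.Sum.Base using (_⊎_)
open import Data.Vec.Base as Vec using (Vec; []; _∷_)
import Data.Vec.Functional as Vector
import Data.Vec.Properties as Vec
open import Level renaming (suc to lsuc; _⊔_ to _⊔ˡ_)
open import Relation.Binary.Core using (Rel)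
open import Relation.Binary.Definitions using (Decidable)
open import Relation.Binary.Structures using (IsStrictPartialOrder)
open import Relation.Nullary.Decidable.Core using (does; yes; no)
open import Relation.Nullary.Negation.Core using (¬_; contradiction)

-- Probabilities live in an arbitrary Archimedean ordered field; the real
-- numbers are the intended instance, and completeness is not required.
-- Two elements are apart (_#_) when one is strictly below the other.
-- Decidability of the order is not assumed, so that constructive versions
-- of the real numbers are covered as well as the classical field ℝ.

record ArchimedeanOrderedField c ℓ₁ ℓ₂ ℓ₃ : Set (lsuc (c ⊔ˡ ℓ₁ ⊔ˡ ℓ₂ ⊔ˡ ℓ₃)) where
  infix 4 _<_ _≤_
  field
    heytingField : HeytingField c ℓ₁ ℓ₂

  open HeytingField heytingField public

  commutativeRing : CommutativeRing c ℓ₁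
  commutativeRing = HeytingCommutativeRing.commutativeRing heytingCommutativeRing

  open RawMonoidDefs (CommutativeRing.+-rawMonoid commutativeRing) public
    using (sum) renaming (_×_ to _·_)

  field
    _<_                  : Rel Carrier ℓ₃
    isStrictPartialOrder : IsStrictPartialOrder _≈_ _<_
    <⇒#                  : ∀ {x y} → x < y → x # y
    #⇒<⊎>                : ∀ {x y} → x # y → x < y ⊎ y < x
    0<1                  : 0# < 1#
    +-monoʳ-<            : ∀ z {x y} → x < y → z + x < z + y
    *-pos                : ∀ {x y} → 0# < x → 0# < y → 0# < x * y
    archimedean          : ∀ x → ∃[ k ] x < k · 1#

  _≤_ : Rel Carrier ℓ₃
  x ≤ y = ¬ (y < x)

-- Iterates an operator binding one variable (an expectation, a maximum) to
-- one binding n variables; for an expectation this is the expectation over n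
-- independent samples.

overVec : ∀ {a r} {A : Set a} {R : Set r} →
          ((A → R) → R) → ∀ n → (Vec A n → R) → R
overVec op zero    g = g []
overVec op (suc n) g = op λ a → overVec op n λ as → g (a ∷ as)

maxFin : ∀ {k} → (Fin k → ℕ) → ℕ
maxFin = Vector.foldr _⊔_ 0

maxBool : (Bool → ℕ) → ℕ
maxBool g = g false ⊔ g true

maxPair : ∀ {p q} → (Fin p × Fin q → ℕ) → ℕ
maxPair g = maxFin λ u → maxFin λ v → g (u , v)

BoolFun : ℕ → Set
BoolFun n = Vec Bool n → Vec Bool n → Bool

EQ : ∀ n → BoolFun n
EQ n x y = does (Vec.≡-dec Bool._≟_ x y)

module SMPModel {c ℓ₁ ℓ₂ ℓ₃} (F : ArchimedeanOrderedField c ℓ₁ ℓ₂ ℓ₃) where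

  open ArchimedeanOrderedField F

  record Distribution (r : ℕ) : Set (c ⊔ˡ ℓ₁ ⊔ˡ ℓ₃) where
    field
      prob   : Fin r → Carrier
      nonneg : ∀ i → 0# ≤ prob i
      total  : sum prob ≈ 1#

  record JointDistribution (p q : ℕ) : Set (c ⊔ˡ ℓ₁ ⊔ˡ ℓ₃) where
    field
      prob   : Fin p → Fin q → Carrier
      nonneg : ∀ u v → 0# ≤ prob u v
      total  : (sum λ u → sum λ v → prob u v) ≈ 1#

    marginalˡ : Fin p → Carrier
    marginalˡ u = sum λ v → prob u v

    marginalʳ : Fin q → Carrier
    marginalʳ v = sum λ u → prob u v

  -- ρ ≠ ρ_U ⊗ ρ_V, with ≠ read as apartness of functions on U × V.  Where
  -- apartness is decidable (as for the classical reals) this is the plain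
  -- negation of equality: see ¬product⇒NotProduct.

  NotProduct : ∀ {p q} → JointDistribution p q → Set ℓ₂
  NotProduct ρ = ∃[ u ] ∃[ v ] prob u v # marginalˡ u * marginalʳ v
    where open JointDistribution ρ

  ¬product⇒NotProduct : Decidable _#_ → ∀ {p q} (ρ : JointDistribution p q) →
    let open JointDistribution ρ in
    ¬ (∀ u v → prob u v ≈ marginalˡ u * marginalʳ v) → NotProduct ρ
  ¬product⇒NotProduct _#?_ ρ ¬product
    with any? (λ u → any? λ v →
           JointDistribution.prob ρ u v
             #? (JointDistribution.marginalˡ ρ u * JointDistribution.marginalʳ ρ v))
  ... | yes apart = apart
  ... | no ¬apart = contradiction
          (λ u v → proj₁ (tight _ _) λ u#v → ¬apart (u , v , u#v)) ¬product

  𝔼 : ∀ {r} → Distribution r → (Fin r → Carrier) → Carrier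
  𝔼 μ g = sum λ i → Distribution.prob μ i * g i

  𝔼₂ : ∀ {p q} → JointDistribution p q → (Fin p × Fin q → Carrier) → Carrier
  𝔼₂ ρ g = sum λ u → sum λ v → JointDistribution.prob ρ u v * g (u , v)

  -- A protocol on inputs in {0,1}ⁿ with a source on Fin p × Fin q.  The last
  -- argument of each party's strategy is its private random seed; the three
  -- seeds are independent of each other and of the source.

  record Protocol (p q n : ℕ) : Set (c ⊔ˡ ℓ₁ ⊔ˡ ℓ₃) where
    field
      samples        : ℕ
      {rᴬ rᴮ rᴿ}     : ℕ
      seedᴬ          : Distribution rᴬ
      seedᴮ          : Distribution rᴮ
      seedᴿ          : Distribution rᴿ
      alice          : Vec Bool n → Vec (Fin p) samples → Fin rᴬ → List Bool
      bob            : Vec Bool n → Vec (Fin q) samples → Fin rᴮ → List Bool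
      referee        : List Bool → List Bool → Fin rᴿ → Bool

    answer : Vec Bool n → Vec Bool n → Vec (Fin p × Fin q) samples →
             Fin rᴬ → Fin rᴮ → Fin rᴿ → Bool
    answer x y s a b r =
      referee (alice x (Vec.map proj₁ s) a) (bob y (Vec.map proj₂ s) b) r

    bits : Vec Bool n → Vec Bool n → Vec (Fin p × Fin q) samples →
           Fin rᴬ → Fin rᴮ → ℕ
    bits x y s a b =
      length (alice x (Vec.map proj₁ s) a) ℕ.+ length (bob y (Vec.map proj₂ s) b)

    -- The maximum ranges over all samples and seeds, including any of
    -- probability zero.

    cost : ℕ
    cost =
      overVec maxBool n λ x → overVec maxBool n λ y →
      overVec maxPair samples λ s → maxFin λ a → maxFin λ b → bits x y s a b

  Pr[answer≡_] : ∀ {n p q} → Bool → JointDistribution p q → Protocol p q n →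
                 Vec Bool n → Vec Bool n → Carrier
  Pr[answer≡ z ] ρ P x y =
    overVec (𝔼₂ ρ) samples λ s → 𝔼 seedᴬ λ a → 𝔼 seedᴮ λ b → 𝔼 seedᴿ λ r →
      if does (answer x y s a b r Bool.≟ z) then 1# else 0#
    where open Protocol P

  HasError : ∀ {n p q} → JointDistribution p q → BoolFun n → Protocol p q n →
             Carrier → Set ℓ₃
  HasError ρ f P δ = ∀ x y → 1# - δ ≤ Pr[answer≡ f x y ] ρ P x y

  -- 3 · δ < 1# says δ < 1/3.

  Solves : ∀ {n p q} → JointDistribution p q → BoolFun n → Protocol p q n →
           Set (c ⊔ˡ ℓ₃)
  Solves ρ f P = ∃[ δ ] 3 · δ < 1# × HasError ρ f P δ

  -- SMP_ρ(f) is a minimum of natural numbers that cannot in general be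
  -- computed; it is at most C when some protocol attains cost at most C.

  SMP[_,_]≤_ : ∀ {n p q} → JointDistribution p q → BoolFun n → ℕ →
               Set (c ⊔ˡ ℓ₁ ⊔ˡ ℓ₃)
  SMP[_,_]≤_ {n} {p} {q} ρ f C =
    ∃ λ (P : Protocol p q n) → Solves ρ f P × Protocol.cost P ℕ.≤ C

{-# OPTIONS --safe #-}

-- The number of samples is not charged for, so every input x can own a sample
-- of its own.  Alice applies a 0/1-valued test f to her half of sample x, Bob
-- applies a test g to his half of sample y: the two bits have the joint law of
-- (f , g) under ρ when x = y and are independent when x ≠ y.  As ρ is not a
-- product, some f and g have positive covariance d.  Bob also sends g of a
-- spare sample, independent of Alice's bit in either case; with bits a, b, b′
-- the expectation of ab − ab′ is then d or 0 according to whether x = y.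
-- Sums over m = r² independent rounds with r d ≥ 4 are told apart by the
-- threshold 2r, and Chebyshev's inequality bounds the error by 1/4.

module Submission where

open import Defs
import Algebra.Apartness.Properties.HeytingCommutativeRing as HeytingProperties
open import Algebra.Bundles using (CommutativeRing)
import Algebra.Properties.Ring as RingProperties
import Algebra.Properties.Semiring.Mult as SemiringMult
import Algebra.Properties.Semiring.Sum as SemiringSum
import Algebra.Solver.Ring.NaturalCoefficients.Default as SemiringSolver
open import Data.Bool.Base using (Bool; true; false; if_then_else_; not; _∧_)
import Data.Bool.Properties as Bool
open import Data.Fin.Base using (Fin; zero; suc; combine)
open import Data.Fin.Properties using (2↔Bool; combine-injective; suc-injective; _≟_)
open import Data.List.Base as List using (List; []; _∷_)
open import Data.Nat.Base as ℕ using (ℕ; zero; suc; _^_)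
import Data.Nat.Properties as ℕ
open import Data.Product.Base using (∃-syntax; _×_; _,_; proj₁; proj₂)
open import Data.Sum.Base using (_⊎_; inj₁; inj₂; [_,_]′)
open import Data.Vec.Base as Vec using (Vec; []; _∷_; lookup; _++_; concat; tabulate; toList)
import Data.Vec.Properties as Vec
open import Function.Base using (_∘_; flip)
open import Function.Bundles using (module Inverse)
open import Level using () renaming (_⊔_ to _⊔ˡ_)
open import Relation.Binary.PropositionalEquality.Core as ≡ using (_≡_; _≢_)
import Relation.Binary.Reasoning.Base.Triple as Triple
open import Relation.Binary.Structures using (IsPreorder; IsStrictPartialOrder)
open import Relation.Nullary.Decidable.Core using (Dec; does; yes; no)
open import Relation.Nullary.Negation.Core using (¬_; contradiction)

-- Numbering of inputs, layout of samples, counting of bits.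

index : ∀ {n} → Vec Bool n → Fin (2 ^ n)
index []      = zero
index (b ∷ x) = combine (Inverse.from 2↔Bool b) (index x)

-- For `x ≢ y` the independence of the two parties' bits rests on their samples being different.
-- Both `combine` and the bijection with `Bool` can be undone digit by digit.
index-injective : ∀ {n} (x y : Vec Bool n) → index x ≡ index y → x ≡ y
index-injective []      []      _  = ≡.refl
index-injective (b ∷ x) (c ∷ y) eq with combine-injective _ (index x) _ (index y) eq
... | b≡c , x≡y = ≡.cong₂ _∷_
  (≡.trans (≡.sym (strictlyInverseˡ b)) (≡.trans (≡.cong to b≡c) (strictlyInverseˡ c)))
  (index-injective x y x≡y)
  where open Inverse 2↔Bool

tabulate≡map : ∀ {A B : Set} {m} {t : Fin m → B} (γ : A → B) (as : Vec A m) →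
  (∀ i → t i ≡ γ (lookup as i)) → tabulate t ≡ Vec.map γ as
tabulate≡map γ as eq = ≡.trans
  (Vec.tabulate-cong λ i → ≡.trans (eq i) (≡.sym (Vec.lookup-map i γ as)))
  (Vec.tabulate∘lookup (Vec.map γ as))

lookup-map-concat : ∀ {A B : Set} {m n} (h : A → B) (ss : Vec (Vec A n) m) i k →
  lookup (Vec.map h (concat ss)) (combine i k) ≡ h (lookup (lookup ss i) k)
lookup-map-concat h ss i k =
  ≡.trans (Vec.lookup-map (combine i k) h (concat ss)) (≡.cong h (Vec.lookup-concat ss i k))

flatten : ∀ {m} → Vec (Bool × Bool) m → List Bool
flatten []             = []
flatten ((b , b′) ∷ v) = b ∷ b′ ∷ flatten v

length-flatten : ∀ {m} (v : Vec (Bool × Bool) m) → List.length (flatten v) ≡ m ℕ.* 2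
length-flatten []      = ≡.refl
length-flatten (_ ∷ v) = ≡.cong (2 ℕ.+_) (length-flatten v)

bit : Bool → ℕ
bit b = if b then 1 else 0

hits : ∀ {A : Set} {m} → (A → Bool) → Vec A m → ℕ
hits γ []       = 0
hits γ (a ∷ as) = bit (γ a) ℕ.+ hits γ as

-- The referee must accept arbitrary lists, hence the catch-all. Messages of the protocol have
-- matching lengths and reach it only when both are exhausted, where 0 is the empty sum.
direct : List Bool → List Bool → ℕ
direct (a ∷ as) (b ∷ _ ∷ bs) = bit (a ∧ b) ℕ.+ direct as bs
direct _        _            = 0

crossed : List Bool → List Bool → ℕ
crossed (a ∷ as) (_ ∷ b′ ∷ bs) = bit (a ∧ b′) ℕ.+ crossed as bs
crossed _        _             = 0

module _ {A : Set} (α β β′ : A → Bool) where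

  direct-hits : ∀ {m} (ss : Vec A m) →
    direct (toList (Vec.map α ss)) (flatten (Vec.map (λ a → β a , β′ a) ss)) ≡ hits (λ a → α a ∧ β a) ss
  direct-hits []       = ≡.refl
  direct-hits (a ∷ ss) = ≡.cong (bit (α a ∧ β a) ℕ.+_) (direct-hits ss)

  crossed-hits : ∀ {m} (ss : Vec A m) →
    crossed (toList (Vec.map α ss)) (flatten (Vec.map (λ a → β a , β′ a) ss)) ≡ hits (λ a → α a ∧ β′ a) ss
  crossed-hits []       = ≡.refl
  crossed-hits (a ∷ ss) = ≡.cong (bit (α a ∧ β′ a) ℕ.+_) (crossed-hits ss)

-- Upper bounds for iterated maxima.

maxFin-lub : ∀ {k C} {g : Fin k → ℕ} → (∀ i → g i ℕ.≤ C) → maxFin g ℕ.≤ C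
maxFin-lub {zero}  g≤C = ℕ.z≤n
maxFin-lub {suc k} g≤C = ℕ.⊔-lub (g≤C zero) (maxFin-lub (g≤C ∘ suc))

maxBool-lub : ∀ {C} {g : Bool → ℕ} → (∀ b → g b ℕ.≤ C) → maxBool g ℕ.≤ C
maxBool-lub g≤C = ℕ.⊔-lub (g≤C false) (g≤C true)

maxPair-lub : ∀ {p q C} {g : Fin p × Fin q → ℕ} → (∀ w → g w ℕ.≤ C) → maxPair g ℕ.≤ C
maxPair-lub g≤C = maxFin-lub λ u → maxFin-lub λ v → g≤C (u , v)

-- With `op` abstract, one induction serves the maxima over inputs (`maxBool`) and over samples
-- (`maxPair`).
overVec-lub : ∀ {A : Set} {C} {op : (A → ℕ) → ℕ} →
  (∀ {g} → (∀ a → g a ℕ.≤ C) → op g ℕ.≤ C) →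
  ∀ n {g} → (∀ s → g s ℕ.≤ C) → overVec op n g ℕ.≤ C
overVec-lub lub zero    g≤C = g≤C []
overVec-lub lub (suc n) g≤C = lub λ a → overVec-lub lub n λ as → g≤C (a ∷ as)

-- Arithmetic in an ordered field without a decidable order.

module OrderedFieldProperties {c ℓ₁ ℓ₂ ℓ₃} (F : ArchimedeanOrderedField c ℓ₁ ℓ₂ ℓ₃) where

  open ArchimedeanOrderedField F hiding (sum; zero)
  open CommutativeRing commutativeRing using (ring; semiring; commutativeSemiring)
  open HeytingProperties heytingCommutativeRing using (x-0≈x; invertibleˡ⇒#)
  open RingProperties ring using (-‿distribˡ-*; -‿distribʳ-*; -‿involutive)
  open SemiringMult semiring using (×-homo-+; ×1-homo-*)
  open SemiringSolver commutativeSemiring using (solve; _:=_; _:*_)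
  module < = IsStrictPartialOrder isStrictPartialOrder

  private variable x y z w : Carrier

  <⇒≤ : x < y → x ≤ y
  <⇒≤ = <.asym

  ≤-reflexive : x ≈ y → x ≤ y
  ≤-reflexive x≈y = <.irrefl (sym x≈y)

  -- Cotransitivity of apartness takes the place of deciding the order. When an apartness points the
  -- unexpected way, transitivity with `x < y` yields the other alternative.
  <-cotrans : x < y → ∀ z → x < z ⊎ z < y
  <-cotrans x<y z with #-cotrans (<⇒# x<y) z
  ... | inj₁ x#z = [ inj₁ , (λ z<x → inj₂ (<.trans z<x x<y)) ]′ (#⇒<⊎> x#z)
  ... | inj₂ z#y = [ inj₂ , (λ y<z → inj₁ (<.trans x<y y<z)) ]′ (#⇒<⊎> z#y)

  <-≤-trans : x < y → y ≤ z → x < z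
  <-≤-trans x<y y≤z = [ (λ x<z → x<z) , flip contradiction y≤z ]′ (<-cotrans x<y _)

  ≤-<-trans : x ≤ y → y < z → x < z
  ≤-<-trans x≤y y<z = [ flip contradiction x≤y , (λ x<z → x<z) ]′ (<-cotrans y<z _)

  ≤-trans : x ≤ y → y ≤ z → x ≤ z
  ≤-trans x≤y y≤z z<x = x≤y (≤-<-trans y≤z z<x)

  ≤-antisym : x ≤ y → y ≤ x → x ≈ y
  ≤-antisym x≤y y≤x = proj₁ (tight _ _) ([ y≤x , x≤y ]′ ∘ #⇒<⊎>)

  ≤-isPreorder : IsPreorder _≈_ _≤_
  ≤-isPreorder = record
    { isEquivalence = isEquivalence
    ; reflexive     = ≤-reflexive
    ; trans         = ≤-trans
    }

  module ≤-Reasoning = Triple ≤-isPreorder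
    <.asym <.trans <.<-resp-≈ <⇒≤ <-≤-trans ≤-<-trans

  open ≤-Reasoning

  +-cancelˡ : ∀ z x → - z + (z + x) ≈ x
  +-cancelˡ z x = begin-equality
    - z + (z + x) ≈⟨ +-assoc (- z) z x ⟨
    - z + z + x   ≈⟨ +-congʳ (-‿inverseˡ z) ⟩
    0# + x        ≈⟨ +-identityˡ x ⟩
    x             ∎

  x+[y-x]≈y : ∀ x y → x + (y - x) ≈ y
  x+[y-x]≈y x y = begin-equality
    x + (y - x) ≈⟨ +-congˡ (+-comm y (- x)) ⟩
    x + (- x + y) ≈⟨ +-assoc x (- x) y ⟨
    x - x + y   ≈⟨ +-congʳ (-‿inverseʳ x) ⟩
    0# + y      ≈⟨ +-identityˡ y ⟩
    y           ∎

  +-cancelˡ-< : ∀ z → z + x < z + y → x < y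
  +-cancelˡ-< {x} {y} z z+x<z+y = begin-strict
    x             ≈⟨ +-cancelˡ z x ⟨
    - z + (z + x) <⟨ +-monoʳ-< (- z) z+x<z+y ⟩
    - z + (z + y) ≈⟨ +-cancelˡ z y ⟩
    y             ∎

  +-cancelˡ-≤ : ∀ z → z + x ≤ z + y → x ≤ y
  +-cancelˡ-≤ z z+x≤z+y y<x = z+x≤z+y (+-monoʳ-< z y<x)

  +-monoʳ-≤ : ∀ z → x ≤ y → z + x ≤ z + y
  +-monoʳ-≤ z x≤y z+y<z+x = x≤y (+-cancelˡ-< z z+y<z+x)

  +-mono-≤ : x ≤ y → z ≤ w → x + z ≤ y + w
  +-mono-≤ {x} {y} {z} {w} x≤y z≤w = begin
    x + z ≤⟨ +-monoʳ-≤ x z≤w ⟩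
    x + w ≈⟨ +-comm x w ⟩
    w + x ≤⟨ +-monoʳ-≤ w x≤y ⟩
    w + y ≈⟨ +-comm w y ⟩
    y + w ∎

  x≤x+y : ∀ x → 0# ≤ y → x ≤ x + y
  x≤x+y {y} x 0≤y = begin
    x      ≈⟨ +-identityʳ x ⟨
    x + 0# ≤⟨ +-monoʳ-≤ x 0≤y ⟩
    x + y  ∎

  x<y⇒0<y-x : x < y → 0# < y - x
  x<y⇒0<y-x {x} {y} x<y = +-cancelˡ-< x (begin-strict
    x + 0#      ≈⟨ +-identityʳ x ⟩
    x           <⟨ x<y ⟩
    y           ≈⟨ x+[y-x]≈y x y ⟨
    x + (y - x) ∎)

  x≤y⇒0≤y-x : x ≤ y → 0# ≤ y - x
  x≤y⇒0≤y-x {x} {y} x≤y = +-cancelˡ-≤ x (begin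
    x + 0#      ≈⟨ +-identityʳ x ⟩
    x           ≤⟨ x≤y ⟩
    y           ≈⟨ x+[y-x]≈y x y ⟨
    x + (y - x) ∎)

  -- Nonnegativity is a negation, so the missing case distinction on the signs
  -- of x and y may be made under a double negation.

  *-nonneg : 0# ≤ x → 0# ≤ y → 0# ≤ x * y
  *-nonneg {x} {y} 0≤x 0≤y xy<0 =
    <.irrefl (trans (*-congʳ (≤-antisym x≤0 0≤x)) (zeroˡ y)) xy<0
    where
    x≤0 : x ≤ 0#
    x≤0 0<x = <.irrefl (trans (*-congˡ (≤-antisym (λ 0<y → <.asym xy<0 (*-pos 0<x 0<y)) 0≤y)) (zeroʳ x)) xy<0

  -x*-y≈x*y : ∀ x y → - x * - y ≈ x * y
  -x*-y≈x*y x y = begin-equality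
    - x * - y     ≈⟨ -‿distribˡ-* x (- y) ⟨
    - (x * - y)   ≈⟨ -‿cong (-‿distribʳ-* x y) ⟨
    - - (x * y)   ≈⟨ -‿involutive (x * y) ⟩
    x * y         ∎

  square-nonneg : ∀ x → 0# ≤ x * x
  square-nonneg x xx<0 = <.irrefl (trans (*-congʳ (≤-antisym x≤0 0≤x)) (zeroˡ x)) xx<0
    where
    x≤0 : x ≤ 0#
    x≤0 0<x = <.asym xx<0 (*-pos 0<x 0<x)
    0≤x : 0# ≤ x
    0≤x x<0 = <.asym xx<0 (<.<-respʳ-≈ (-x*-y≈x*y x x) (*-pos 0<-x 0<-x))
      where
      0<-x : 0# < - x
      0<-x = <.<-respʳ-≈ (+-identityˡ (- x)) (x<y⇒0<y-x x<0)

  *-monoˡ-≤ : 0# ≤ z → x ≤ y → z * x ≤ z * y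
  *-monoˡ-≤ {z} {x} {y} 0≤z x≤y = begin
    z * x               ≤⟨ x≤x+y (z * x) (*-nonneg 0≤z (x≤y⇒0≤y-x x≤y)) ⟩
    z * x + z * (y - x) ≈⟨ distribˡ z x (y - x) ⟨
    z * (x + (y - x))   ≈⟨ *-congˡ (x+[y-x]≈y x y) ⟩
    z * y               ∎

  *-monoˡ-< : 0# < z → x < y → z * x < z * y
  *-monoˡ-< {z} {x} {y} 0<z x<y = begin-strict
    z * x               ≈⟨ +-identityʳ (z * x) ⟨
    z * x + 0#          <⟨ +-monoʳ-< (z * x) (*-pos 0<z (x<y⇒0<y-x x<y)) ⟩
    z * x + z * (y - x) ≈⟨ distribˡ z x (y - x) ⟨
    z * (x + (y - x))   ≈⟨ *-congˡ (x+[y-x]≈y x y) ⟩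
    z * y               ∎

  square-mono-≤ : 0# ≤ x → x ≤ y → x * x ≤ y * y
  square-mono-≤ {x} {y} 0≤x x≤y = begin
    x * x ≤⟨ *-monoˡ-≤ 0≤x x≤y ⟩
    x * y ≈⟨ *-comm x y ⟩
    y * x ≤⟨ *-monoˡ-≤ (≤-trans 0≤x x≤y) x≤y ⟩
    y * y ∎

  -- The hypotheses give `0 ≤ x ≤ - y`, and squaring does not see the sign. In this form a deviation
  -- far below zero enters Chebyshev's inequality.
  square-mono-≤-neg : 0# ≤ x → x + y ≤ 0# → x * x ≤ y * y
  square-mono-≤-neg {x} {y} 0≤x x+y≤0 = begin
    x * x     ≤⟨ square-mono-≤ 0≤x x≤-y ⟩
    - y * - y ≈⟨ -x*-y≈x*y y y ⟩
    y * y     ∎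
    where
    x≤-y : x ≤ - y
    x≤-y = +-cancelˡ-≤ y (begin
      y + x   ≈⟨ +-comm y x ⟩
      x + y   ≤⟨ x+y≤0 ⟩
      0#      ≈⟨ -‿inverseʳ y ⟨
      y + - y ∎)

  inverse : 0# < x → ∃[ y ] 0# < y × x * y ≈ 1#
  inverse {x} 0<x with #⇒invertible (#-sym (<⇒# 0<x))
  ... | y , y[x-0]≈1 , _ = y , 0<y , xy≈1
    where
    xy≈1 : x * y ≈ 1#
    xy≈1 = begin-equality
      x * y        ≈⟨ *-comm x y ⟩
      y * x        ≈⟨ *-congˡ (x-0≈x x) ⟨
      y * (x - 0#) ≈⟨ y[x-0]≈1 ⟩
      1#           ∎
    y≮0 : 0# ≤ y
    y≮0 y<0 = <.asym 0<1 (begin-strict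
      1#     ≈⟨ xy≈1 ⟨
      x * y  <⟨ *-monoˡ-< 0<x y<0 ⟩
      x * 0# ≈⟨ zeroʳ x ⟩
      0#     ∎)
    -- Refuting `y < 0` gives only `0 ≤ y`; strictness comes from `y` being invertible and hence
    -- apart from zero.
    0<y : 0# < y
    0<y = [ flip contradiction y≮0 , (λ 0<y → 0<y) ]′
      (#⇒<⊎> (invertibleˡ⇒# (x , trans (*-congˡ (x-0≈x y)) xy≈1)))

  ⟦_⟧ : ℕ → Carrier
  ⟦ n ⟧ = n · 1#

  ⟦⟧-homo-+ : ∀ m n → ⟦ m ℕ.+ n ⟧ ≈ ⟦ m ⟧ + ⟦ n ⟧
  ⟦⟧-homo-+ = ×-homo-+ 1#

  ⟦⟧-homo-* : ∀ m n → ⟦ m ℕ.* n ⟧ ≈ ⟦ m ⟧ * ⟦ n ⟧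
  ⟦⟧-homo-* = ×1-homo-*

  0≤⟦⟧ : ∀ n → 0# ≤ ⟦ n ⟧
  0≤⟦⟧ zero    = ≤-reflexive refl
  0≤⟦⟧ (suc n) = ≤-trans (<⇒≤ 0<1) (x≤x+y 1# (0≤⟦⟧ n))

  0<⟦suc⟧ : ∀ n → 0# < ⟦ suc n ⟧
  0<⟦suc⟧ n = <-≤-trans 0<1 (x≤x+y 1# (0≤⟦⟧ n))

  ⟦⟧-mono-≤ : ∀ {m n} → m ℕ.≤ n → ⟦ m ⟧ ≤ ⟦ n ⟧
  ⟦⟧-mono-≤ {n = n} ℕ.z≤n       = 0≤⟦⟧ n
  ⟦⟧-mono-≤         (ℕ.s≤s m≤n) = +-monoʳ-≤ 1# (⟦⟧-mono-≤ m≤n)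

  -- The Archimedean property is applied to `x / d`. The successor keeps the multiplier positive, so
  -- that the threshold built from it is not zero.
  ∃-multiple : ∀ {d} → 0# < d → ∀ x → ∃[ r ] x ≤ ⟦ suc r ⟧ * d
  ∃-multiple {d} 0<d x with inverse 0<d
  ... | e , _ , de≈1 with archimedean (x * e)
  ...   | r , xe<r = r , (begin
    x             ≈⟨ *-identityʳ x ⟨
    x * 1#        ≈⟨ *-congˡ de≈1 ⟨
    x * (d * e)   ≈⟨ solve 3 (λ x d e → x :* (d :* e) := d :* (x :* e)) refl x d e ⟩
    d * (x * e)   <⟨ *-monoˡ-< 0<d xe<r ⟩
    d * ⟦ r ⟧     ≤⟨ *-monoˡ-≤ (<⇒≤ 0<d) (⟦⟧-mono-≤ (ℕ.n≤1+n r)) ⟩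
    d * ⟦ suc r ⟧ ≈⟨ *-comm d ⟦ suc r ⟧ ⟩
    ⟦ suc r ⟧ * d ∎)

-- Expectations, independence and second moments.

module Expectations {c ℓ₁ ℓ₂ ℓ₃} (F : ArchimedeanOrderedField c ℓ₁ ℓ₂ ℓ₃) where

  open ArchimedeanOrderedField F hiding (sum; zero)
  open CommutativeRing commutativeRing using (ring; semiring; commutativeSemiring)
  open RingProperties ring using (-1*x≈-x)
  open OrderedFieldProperties F
  open SemiringSolver commutativeSemiring using (solve; _:=_; _:+_; _:*_)
  open SemiringSum semiring using (sum; sum-cong-≋; ∑-distrib-+; *-distribˡ-sum; *-distribʳ-sum)
  open SMPModel F
  open ≤-Reasoning

  -- This interface is preserved by `overVec`, so it applies alike to one sample, to a chunk of
  -- samples and to a sequence of chunks. Independence is not a field: it comes from the nesting.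
  record IsExpectation {A : Set} (E : (A → Carrier) → Carrier) : Set (c ⊔ˡ ℓ₁ ⊔ˡ ℓ₃) where
    field
      E-cong  : ∀ {g h} → (∀ a → g a ≈ h a) → E g ≈ E h
      E-mono  : ∀ {g h} → (∀ a → g a ≤ h a) → E g ≤ E h
      E-+     : ∀ g h → E (λ a → g a + h a) ≈ E g + E h
      E-*     : ∀ k g → E (λ a → k * g a) ≈ k * E g
      E-const : ∀ k → E (λ _ → k) ≈ k

    E-*ʳ : ∀ k g → E (λ a → g a * k) ≈ E g * k
    E-*ʳ k g = begin-equality
      E (λ a → g a * k) ≈⟨ E-cong (λ a → *-comm (g a) k) ⟩
      E (λ a → k * g a) ≈⟨ E-* k g ⟩
      k * E g           ≈⟨ *-comm k (E g) ⟩
      E g * k           ∎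

    E-- : ∀ g h → E (λ a → g a - h a) ≈ E g - E h
    E-- g h = begin-equality
      E (λ a → g a - h a)        ≈⟨ E-+ g (λ a → - h a) ⟩
      E g + E (λ a → - h a)      ≈⟨ +-congˡ (E-cong λ a → -1*x≈-x (h a)) ⟨
      E g + E (λ a → - 1# * h a) ≈⟨ +-congˡ (E-* (- 1#) h) ⟩
      E g + - 1# * E h           ≈⟨ +-congˡ (-1*x≈-x (E h)) ⟩
      E g - E h                  ∎

    E-+const : ∀ g k → E (λ a → g a + k) ≈ E g + k
    E-+const g k = trans (E-+ g (λ _ → k)) (+-congˡ (E-const k))

  open IsExpectation

  overVec-isExpectation : ∀ {A : Set} {E : (A → Carrier) → Carrier} → IsExpectation E →
                          ∀ n → IsExpectation (overVec E n)
  overVec-isExpectation isE zero = record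
    { E-cong  = λ g≈h → g≈h []
    ; E-mono  = λ g≤h → g≤h []
    ; E-+     = λ _ _ → refl
    ; E-*     = λ _ _ → refl
    ; E-const = λ _ → refl
    }
  overVec-isExpectation isE (suc n) = record
    { E-cong  = λ g≈h → E-cong isE λ a → E-cong isEⁿ λ as → g≈h (a ∷ as)
    ; E-mono  = λ g≤h → E-mono isE λ a → E-mono isEⁿ λ as → g≤h (a ∷ as)
    ; E-+     = λ g h → trans (E-cong isE λ a → E-+ isEⁿ (g ∘ (a ∷_)) (h ∘ (a ∷_))) (E-+ isE _ _)
    ; E-*     = λ k g → trans (E-cong isE λ a → E-* isEⁿ k (g ∘ (a ∷_))) (E-* isE k _)
    ; E-const = λ k → trans (E-cong isE λ _ → E-const isEⁿ k) (E-const isE k)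
    }
    where isEⁿ = overVec-isExpectation isE n

  sum-mono-≤ : ∀ {n} {g h : Fin n → Carrier} → (∀ i → g i ≤ h i) → sum g ≤ sum h
  sum-mono-≤ {zero}  g≤h = ≤-reflexive refl
  sum-mono-≤ {suc n} g≤h = +-mono-≤ (g≤h zero) (sum-mono-≤ (g≤h ∘ suc))

  𝔼-const : ∀ {r} (μ : Distribution r) k → 𝔼 μ (λ _ → k) ≈ k
  𝔼-const μ k = begin-equality
    sum (λ i → prob i * k) ≈⟨ *-distribʳ-sum k prob ⟨
    sum prob * k           ≈⟨ *-congʳ total ⟩
    1# * k                 ≈⟨ *-identityˡ k ⟩
    k                      ∎
    where open Distribution μ

  𝔼₂-isExpectation : ∀ {p q} (ρ : JointDistribution p q) → IsExpectation (𝔼₂ ρ)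
  𝔼₂-isExpectation ρ = record
    { E-cong = λ g≈h → ∑∑-cong λ u v → *-congˡ (g≈h (u , v))
    ; E-mono = λ g≤h → sum-mono-≤ λ u → sum-mono-≤ λ v → *-monoˡ-≤ (nonneg u v) (g≤h (u , v))
    ; E-+ = λ g h → begin-equality
        (sum λ u → sum λ v → prob u v * (g (u , v) + h (u , v)))
          ≈⟨ ∑∑-cong (λ u v → distribˡ (prob u v) (g (u , v)) (h (u , v))) ⟩
        (sum λ u → sum λ v → prob u v * g (u , v) + prob u v * h (u , v))
          ≈⟨ sum-cong-≋ (λ u → ∑-distrib-+ (λ v → prob u v * g (u , v)) (λ v → prob u v * h (u , v))) ⟩
        (sum λ u → (sum λ v → prob u v * g (u , v)) + (sum λ v → prob u v * h (u , v)))
          ≈⟨ ∑-distrib-+ (λ u → sum λ v → prob u v * g (u , v)) (λ u → sum λ v → prob u v * h (u , v)) ⟩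
        𝔼₂ ρ g + 𝔼₂ ρ h ∎
    ; E-* = λ k g → begin-equality
        (sum λ u → sum λ v → prob u v * (k * g (u , v)))
          ≈⟨ ∑∑-cong (λ u v → solve 3 (λ a k b → a :* (k :* b) := k :* (a :* b)) refl (prob u v) k (g (u , v))) ⟩
        (sum λ u → sum λ v → k * (prob u v * g (u , v)))
          ≈⟨ sum-cong-≋ (λ u → *-distribˡ-sum k (λ v → prob u v * g (u , v))) ⟨
        (sum λ u → k * sum λ v → prob u v * g (u , v))
          ≈⟨ *-distribˡ-sum k (λ u → sum λ v → prob u v * g (u , v)) ⟨
        k * 𝔼₂ ρ g ∎
    ; E-const = λ k → begin-equality
        (sum λ u → sum λ v → prob u v * k)
          ≈⟨ sum-cong-≋ (λ u → *-distribʳ-sum k (prob u)) ⟨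
        (sum λ u → sum (prob u) * k)
          ≈⟨ *-distribʳ-sum k (λ u → sum (prob u)) ⟨
        (sum λ u → sum (prob u)) * k
          ≈⟨ *-congʳ total ⟩
        1# * k
          ≈⟨ *-identityˡ k ⟩
        k ∎
    }
    where
    open JointDistribution ρ
    ∑∑-cong : ∀ {g h : Fin _ → Fin _ → Carrier} → (∀ u v → g u v ≈ h u v) →
              (sum λ u → sum (g u)) ≈ (sum λ u → sum (h u))
    ∑∑-cong g≈h = sum-cong-≋ λ u → sum-cong-≋ (g≈h u)

  ∑ : ∀ {A : Set} {n} → (A → Carrier) → Vec A n → Carrier
  ∑ X []       = 0#
  ∑ X (a ∷ as) = X a + ∑ X as

  module _ {A : Set} {E : (A → Carrier) → Carrier} (isE : IsExpectation E) where

    overVec-lookup : ∀ {n} (i : Fin n) h → overVec E n (λ s → h (lookup s i)) ≈ E h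
    overVec-lookup {suc n} zero    h = E-cong isE λ a → E-const (overVec-isExpectation isE n) (h a)
    overVec-lookup {suc n} (suc i) h = trans (E-const isE _) (overVec-lookup i h)

    -- At the earlier of the two coordinates, its factor is constant for all later expectations and
    -- can be pulled out. What is left depends on a single coordinate.
    overVec-lookup-independent : ∀ {n} {i j : Fin n} → i ≢ j → ∀ g h →
      overVec E n (λ s → g (lookup s i) * h (lookup s j)) ≈ E g * E h
    overVec-lookup-independent {suc n} {zero}  {zero}  i≢j g h = contradiction ≡.refl i≢j
    overVec-lookup-independent {suc n} {zero}  {suc j} i≢j g h = begin-equality
      E (λ a → overVec E n λ s → g a * h (lookup s j))
        ≈⟨ E-cong isE (λ a → E-* (overVec-isExpectation isE n) (g a) (λ s → h (lookup s j))) ⟩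
      E (λ a → g a * overVec E n λ s → h (lookup s j))
        ≈⟨ E-*ʳ isE _ g ⟩
      E g * (overVec E n λ s → h (lookup s j))
        ≈⟨ *-congˡ (overVec-lookup j h) ⟩
      E g * E h ∎
    overVec-lookup-independent {suc n} {suc i} {zero}  i≢j g h = begin-equality
      E (λ a → overVec E n λ s → g (lookup s i) * h a)
        ≈⟨ E-cong isE (λ a → E-*ʳ (overVec-isExpectation isE n) (h a) (λ s → g (lookup s i))) ⟩
      E (λ a → (overVec E n λ s → g (lookup s i)) * h a)
        ≈⟨ E-* isE _ h ⟩
      (overVec E n λ s → g (lookup s i)) * E h
        ≈⟨ *-congʳ (overVec-lookup i g) ⟩
      E g * E h ∎
    overVec-lookup-independent {suc n} {suc i} {suc j} i≢j g h =
      trans (E-const isE _) (overVec-lookup-independent (i≢j ∘ ≡.cong suc) g h)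

    overVec-++ : ∀ m {n} (g : Vec A (m ℕ.+ n) → Carrier) →
      overVec E (m ℕ.+ n) g ≈ overVec E m λ s → overVec E n λ t → g (s ++ t)
    overVec-++ zero    g = refl
    overVec-++ (suc m) g = E-cong isE λ a → overVec-++ m (g ∘ (a ∷_))

    -- Turns the flat sample vector of the protocol into `m` independent draws of a chunk of `n`
    -- samples.
    overVec-concat : ∀ m n (g : Vec A (m ℕ.* n) → Carrier) →
      overVec E (m ℕ.* n) g ≈ overVec (overVec E n) m (g ∘ concat)
    overVec-concat zero    n g = refl
    overVec-concat (suc m) n g = trans (overVec-++ n g)
      (E-cong (overVec-isExpectation isE n) λ s → overVec-concat m n (g ∘ (s ++_)))

    module _ {X : A → Carrier} (EX≈0 : E X ≈ 0#) where

      overVec-∑ : ∀ n → overVec E n (∑ X) ≈ 0#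
      overVec-∑ zero    = refl
      overVec-∑ (suc n) = begin-equality
        E (λ a → overVec E n λ as → X a + ∑ X as)
          ≈⟨ E-cong isE (λ a → trans (E-+ (isEⁿ n) (λ _ → X a) (∑ X)) (+-cong (E-const (isEⁿ n) (X a)) (overVec-∑ n))) ⟩
        E (λ a → X a + 0#)
          ≈⟨ E-+const isE X 0# ⟩
        E X + 0#
          ≈⟨ +-identityʳ (E X) ⟩
        E X
          ≈⟨ EX≈0 ⟩
        0# ∎
        where isEⁿ = overVec-isExpectation isE

      -- Variances of independent centred variables add: once the first variable is split off, the
      -- cross term contains the mean of the remaining sum, which is zero by `overVec-∑`.
      second-moment-∑ : E (λ a → X a * X a) ≤ 1# →
                        ∀ n → overVec E n (λ as → ∑ X as * ∑ X as) ≤ ⟦ n ⟧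
      second-moment-∑ EX²≤1 zero    = ≤-reflexive (zeroˡ 0#)
      second-moment-∑ EX²≤1 (suc n) = begin
        E (λ a → Eⁿ λ as → (X a + ∑ X as) * (X a + ∑ X as))
          ≈⟨ E-cong isE inner ⟩
        E (λ a → X a * X a + V)
          ≈⟨ E-+const isE (λ a → X a * X a) V ⟩
        E (λ a → X a * X a) + V
          ≤⟨ +-mono-≤ EX²≤1 (second-moment-∑ EX²≤1 n) ⟩
        1# + ⟦ n ⟧ ∎
        where
        Eⁿ = overVec E n
        isEⁿ = overVec-isExpectation isE n
        V = Eⁿ λ as → ∑ X as * ∑ X as
        inner : ∀ a → Eⁿ (λ as → (X a + ∑ X as) * (X a + ∑ X as)) ≈ X a * X a + V
        inner a = begin-equality
          Eⁿ (λ as → (X a + ∑ X as) * (X a + ∑ X as))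
            ≈⟨ E-cong isEⁿ (λ as → solve 2
                 (λ x s → (x :+ s) :* (x :+ s) := (x :+ x) :* s :+ (s :* s :+ x :* x)) refl (X a) (∑ X as)) ⟩
          Eⁿ (λ as → (X a + X a) * ∑ X as + (∑ X as * ∑ X as + X a * X a))
            ≈⟨ E-+ isEⁿ (λ as → (X a + X a) * ∑ X as) (λ as → ∑ X as * ∑ X as + X a * X a) ⟩
          Eⁿ (λ as → (X a + X a) * ∑ X as) + Eⁿ (λ as → ∑ X as * ∑ X as + X a * X a)
            ≈⟨ +-cong (E-* isEⁿ (X a + X a) (∑ X)) (E-+const isEⁿ (λ as → ∑ X as * ∑ X as) (X a * X a)) ⟩
          (X a + X a) * Eⁿ (∑ X) + (V + X a * X a)
            ≈⟨ +-congʳ (trans (*-congˡ (overVec-∑ n)) (zeroʳ (X a + X a))) ⟩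
          0# + (V + X a * X a)
            ≈⟨ +-identityˡ _ ⟩
          V + X a * X a
            ≈⟨ +-comm V (X a * X a) ⟩
          X a * X a + V ∎

    module _ {T : A → Carrier} {τ : Carrier} (ET≈τ : E T ≈ τ) where

      centred-mean : E (λ a → T a - τ) ≈ 0#
      centred-mean = begin-equality
        E (λ a → T a - τ) ≈⟨ E-+const isE T (- τ) ⟩
        E T - τ           ≈⟨ +-congʳ ET≈τ ⟩
        τ - τ             ≈⟨ -‿inverseʳ τ ⟩
        0#                ∎

      centred-second-moment : (∀ a → T a * T a ≤ 1#) → E (λ a → (T a - τ) * (T a - τ)) ≤ 1#
      centred-second-moment T²≤1 = begin
        E (λ a → X a * X a)
          ≤⟨ x≤x+y _ (square-nonneg τ) ⟩
        E (λ a → X a * X a) + τ * τ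
          -- The square `τ * τ` becomes `τ * E X + τ * E T`, as `E X ≈ 0` and `E T ≈ τ`. With `T`
          -- written as `τ + X`, the pointwise identity `X² + τX + τT = T²` is then free of
          -- subtraction and within reach of the semiring solver.
          ≈⟨ +-congˡ (trans (+-congʳ (trans (*-congˡ centred-mean) (zeroʳ τ))) (+-identityˡ (τ * τ))) ⟨
        E (λ a → X a * X a) + (τ * E X + τ * τ)
          ≈⟨ +-congˡ (+-congˡ (*-congˡ ET≈τ)) ⟨
        E (λ a → X a * X a) + (τ * E X + τ * E T)
          ≈⟨ +-congˡ (+-cong (E-* isE τ X) (E-* isE τ T)) ⟨
        E (λ a → X a * X a) + (E (λ a → τ * X a) + E (λ a → τ * T a))
          ≈⟨ +-congˡ (E-+ isE (λ a → τ * X a) (λ a → τ * T a)) ⟨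
        E (λ a → X a * X a) + E (λ a → τ * X a + τ * T a)
          ≈⟨ E-+ isE (λ a → X a * X a) (λ a → τ * X a + τ * T a) ⟨
        E (λ a → X a * X a + (τ * X a + τ * T a))
          ≈⟨ E-cong isE expand ⟩
        E (λ a → T a * T a)
          ≤⟨ E-mono isE T²≤1 ⟩
        E (λ _ → 1#)
          ≈⟨ E-const isE 1# ⟩
        1# ∎
        where
        X : A → Carrier
        X a = T a - τ
        expand : ∀ a → X a * X a + (τ * X a + τ * T a) ≈ T a * T a
        expand a = begin-equality
          X a * X a + (τ * X a + τ * T a)
            ≈⟨ +-congˡ (+-congˡ (*-congˡ (x+[y-x]≈y τ (T a)))) ⟨
          X a * X a + (τ * X a + τ * (τ + X a))
            ≈⟨ solve 2 (λ t x → x :* x :+ (t :* x :+ t :* (t :+ x)) := (t :+ x) :* (t :+ x)) refl τ (X a) ⟩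
          (τ + X a) * (τ + X a)
            ≈⟨ *-cong (x+[y-x]≈y τ (T a)) (x+[y-x]≈y τ (T a)) ⟩
          T a * T a ∎

-- Correlated tests from a source that is not a product.

module Correlation {c ℓ₁ ℓ₂ ℓ₃} (F : ArchimedeanOrderedField c ℓ₁ ℓ₂ ℓ₃) where

  open ArchimedeanOrderedField F hiding (sum; zero)
  open CommutativeRing commutativeRing using (semiring)
  open OrderedFieldProperties F
  open Expectations F
  open SemiringSum semiring using (sum; sum-cong-≋; *-distribʳ-sum)
  open SMPModel F
  open IsExpectation
  open ≤-Reasoning

  𝟙 : Bool → Carrier
  𝟙 b = if b then 1# else 0#

  𝟙-∧ : ∀ a b → 𝟙 (a ∧ b) ≈ 𝟙 a * 𝟙 b
  𝟙-∧ true  b = sym (*-identityˡ (𝟙 b))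
  𝟙-∧ false b = sym (zeroˡ (𝟙 b))

  𝟙-not : ∀ b → 𝟙 (not b) + 𝟙 b ≈ 1#
  𝟙-not true  = +-identityˡ 1#
  𝟙-not false = +-identityʳ 1#

  infix 4 _is_
  _is_ : ∀ {n} → Fin n → Fin n → Bool
  i is k = does (i ≟ k)

  sum-𝟙-is : ∀ {n} (k : Fin n) (h : Fin n → Carrier) → sum (λ i → h i * 𝟙 (i is k)) ≈ h k
  sum-𝟙-is zero h = begin-equality
    h zero * 1# + sum (λ i → h (suc i) * 0#) ≈⟨ +-cong (*-identityʳ (h zero)) (sym (*-distribʳ-sum 0# (h ∘ suc))) ⟩
    h zero + sum (h ∘ suc) * 0#              ≈⟨ +-congˡ (zeroʳ (sum (h ∘ suc))) ⟩
    h zero + 0#                              ≈⟨ +-identityʳ (h zero) ⟩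
    h zero                                   ∎
  sum-𝟙-is (suc k) h = begin-equality
    h zero * 0# + sum (λ i → h (suc i) * 𝟙 (i is k)) ≈⟨ +-cong (zeroʳ (h zero)) (sum-𝟙-is k (h ∘ suc)) ⟩
    0# + h (suc k)                                   ≈⟨ +-identityˡ (h (suc k)) ⟩
    h (suc k)                                        ∎

  module _ {p q} (ρ : JointDistribution p q) where

    open JointDistribution ρ

    private
      isE = 𝔼₂-isExpectation ρ

    𝟙ˡ : (Fin p → Bool) → Fin p × Fin q → Carrier
    𝟙ˡ f = 𝟙 ∘ f ∘ proj₁

    𝟙ʳ : (Fin q → Bool) → Fin p × Fin q → Carrier
    𝟙ʳ g = 𝟙 ∘ g ∘ proj₂

    𝟙ˡʳ : (Fin p → Bool) → (Fin q → Bool) → Fin p × Fin q → Carrier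
    𝟙ˡʳ f g w = 𝟙ˡ f w * 𝟙ʳ g w

    PositivelyCorrelated : (Fin p → Bool) → (Fin q → Bool) → Set ℓ₃
    PositivelyCorrelated f g = 𝔼₂ ρ (𝟙ˡ f) * 𝔼₂ ρ (𝟙ʳ g) < 𝔼₂ ρ (𝟙ˡʳ f g)

    -- Complementing a test reverses the sign of the covariance: the joint moments of `f` and
    -- `not ∘ f` with `g` add up to `E g`, and so do the products of means. A deficit for `f` is
    -- thus an excess for its complement.
    not-correlated : ∀ f g → 𝔼₂ ρ (𝟙ˡʳ f g) < 𝔼₂ ρ (𝟙ˡ f) * 𝔼₂ ρ (𝟙ʳ g) →
                     PositivelyCorrelated (not ∘ f) g
    not-correlated f g neg = +-cancelˡ-< (𝔼₂ ρ (𝟙ˡʳ f g)) (begin-strict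
      fg + f′ * g₀             ≈⟨ +-comm fg (f′ * g₀) ⟩
      f′ * g₀ + fg             <⟨ +-monoʳ-< (f′ * g₀) neg ⟩
      f′ * g₀ + f₀ * g₀        ≈⟨ distribʳ g₀ f′ f₀ ⟨
      (f′ + f₀) * g₀           ≈⟨ *-congʳ (E-+ isE (𝟙ˡ (not ∘ f)) (𝟙ˡ f)) ⟨
      𝔼₂ ρ (λ w → 𝟙ˡ (not ∘ f) w + 𝟙ˡ f w) * g₀
                               ≈⟨ *-congʳ (trans (E-cong isE λ w → 𝟙-not (f (proj₁ w))) (E-const isE 1#)) ⟩
      1# * g₀                  ≈⟨ *-identityˡ g₀ ⟩
      g₀                       ≈⟨ E-cong isE (λ w → trans (*-congʳ (𝟙-not (f (proj₁ w)))) (*-identityˡ (𝟙ʳ g w))) ⟨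
      𝔼₂ ρ (λ w → (𝟙ˡ (not ∘ f) w + 𝟙ˡ f w) * 𝟙ʳ g w)
                               ≈⟨ E-cong isE (λ w → trans (distribʳ (𝟙ʳ g w) _ _) (+-comm _ _)) ⟩
      𝔼₂ ρ (λ w → 𝟙ˡʳ f g w + 𝟙ˡʳ (not ∘ f) g w)
                               ≈⟨ E-+ isE (𝟙ˡʳ f g) (𝟙ˡʳ (not ∘ f) g) ⟩
      fg + 𝔼₂ ρ (𝟙ˡʳ (not ∘ f) g) ∎)
      where
      fg = 𝔼₂ ρ (𝟙ˡʳ f g)
      f₀ = 𝔼₂ ρ (𝟙ˡ f)
      f′ = 𝔼₂ ρ (𝟙ˡ (not ∘ f))
      g₀ = 𝔼₂ ρ (𝟙ʳ g)

    𝔼₂-𝟙ˡ-is : ∀ u → 𝔼₂ ρ (𝟙ˡ (_is u)) ≈ marginalˡ u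
    𝔼₂-𝟙ˡ-is u = trans
      (sum-cong-≋ λ i → sym (*-distribʳ-sum (𝟙 (i is u)) (prob i)))
      (sum-𝟙-is u marginalˡ)

    𝔼₂-𝟙ʳ-is : ∀ v → 𝔼₂ ρ (𝟙ʳ (_is v)) ≈ marginalʳ v
    𝔼₂-𝟙ʳ-is v = sum-cong-≋ λ i → sum-𝟙-is v (prob i)

    𝔼₂-𝟙ˡʳ-is : ∀ u v → 𝔼₂ ρ (𝟙ˡʳ (_is u) (_is v)) ≈ prob u v
    𝔼₂-𝟙ˡʳ-is u v = begin-equality
      (sum λ i → sum λ j → prob i j * (𝟙 (i is u) * 𝟙 (j is v)))
        ≈⟨ sum-cong-≋ (λ i → sum-cong-≋ λ j → *-assoc (prob i j) (𝟙 (i is u)) (𝟙 (j is v))) ⟨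
      (sum λ i → sum λ j → prob i j * 𝟙 (i is u) * 𝟙 (j is v))
        ≈⟨ sum-cong-≋ (λ i → sum-𝟙-is v (λ j → prob i j * 𝟙 (i is u))) ⟩
      (sum λ i → prob i v * 𝟙 (i is u))
        ≈⟨ sum-𝟙-is u (λ i → prob i v) ⟩
      prob u v ∎

    -- For the point indicators of `u` and `v`, the covariance compares `prob u v` with the product
    -- of the marginals. If it is negative, the first test is complemented.
    ∃-positivelyCorrelated : NotProduct ρ → ∃[ f ] ∃[ g ] PositivelyCorrelated f g
    ∃-positivelyCorrelated (u , v , apart) with #⇒<⊎> apart
    ... | inj₁ less = not ∘ (_is u) , (_is v) , not-correlated (_is u) (_is v) (begin-strict
      𝔼₂ ρ (𝟙ˡʳ (_is u) (_is v))                 ≈⟨ 𝔼₂-𝟙ˡʳ-is u v ⟩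
      prob u v                                   <⟨ less ⟩
      marginalˡ u * marginalʳ v                  ≈⟨ *-cong (𝔼₂-𝟙ˡ-is u) (𝔼₂-𝟙ʳ-is v) ⟨
      𝔼₂ ρ (𝟙ˡ (_is u)) * 𝔼₂ ρ (𝟙ʳ (_is v))      ∎)
    ... | inj₂ more = (_is u) , (_is v) , (begin-strict
      𝔼₂ ρ (𝟙ˡ (_is u)) * 𝔼₂ ρ (𝟙ʳ (_is v))      ≈⟨ *-cong (𝔼₂-𝟙ˡ-is u) (𝔼₂-𝟙ʳ-is v) ⟩
      marginalˡ u * marginalʳ v                  <⟨ more ⟩
      prob u v                                   ≈⟨ 𝔼₂-𝟙ˡʳ-is u v ⟨
      𝔼₂ ρ (𝟙ˡʳ (_is u) (_is v))                 ∎)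

-- The threshold test and its error by Chebyshev's inequality.

module Testing {c ℓ₁ ℓ₂ ℓ₃} (F : ArchimedeanOrderedField c ℓ₁ ℓ₂ ℓ₃) where

  open ArchimedeanOrderedField F hiding (sum; zero)
  open CommutativeRing commutativeRing using (semiring; commutativeSemiring)
  open HeytingProperties heytingCommutativeRing using (x-0≈x)
  open SemiringMult semiring using (×-assoc-*; ×-congʳ)
  open OrderedFieldProperties F
  open Expectations F
  open Correlation F
  open SemiringSolver commutativeSemiring using (solve; _:=_; _:+_; _:*_; con)
  open SMPModel F
  open IsExpectation
  open ≤-Reasoning

  ⟦bit⟧ : ∀ b → ⟦ bit b ⟧ ≈ 𝟙 b
  ⟦bit⟧ true  = +-identityʳ 1#
  ⟦bit⟧ false = refl

  0²≤1 : 0# * 0# ≤ 1#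
  0²≤1 = ≤-trans (≤-reflexive (zeroˡ 0#)) (<⇒≤ 0<1)

  1²≤1 : 1# * 1# ≤ 1#
  1²≤1 = ≤-reflexive (*-identityˡ 1#)

  square-≤-respˡ-≈ : ∀ {x y z} → x ≈ y → y * y ≤ z → x * x ≤ z
  square-≤-respˡ-≈ x≈y = ≤-trans (≤-reflexive (*-cong x≈y x≈y))

  [𝟙-𝟙]²≤1 : ∀ a b → (𝟙 a - 𝟙 b) * (𝟙 a - 𝟙 b) ≤ 1#
  [𝟙-𝟙]²≤1 true  true  = square-≤-respˡ-≈ (-‿inverseʳ 1#) 0²≤1
  [𝟙-𝟙]²≤1 true  false = square-≤-respˡ-≈ (x-0≈x 1#) 1²≤1
  [𝟙-𝟙]²≤1 false true  = square-≤-respˡ-≈ (+-identityˡ (- 1#))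
                           (≤-trans (≤-reflexive (-x*-y≈x*y 1# 1#)) 1²≤1)
  [𝟙-𝟙]²≤1 false false = square-≤-respˡ-≈ (-‿inverseʳ 0#) 0²≤1

  ⟦4⟧* : ∀ x → ⟦ 4 ⟧ * x ≈ (x + x) + (x + x)
  ⟦4⟧* = solve 1 (λ x → (con 1 :+ (con 1 :+ (con 1 :+ (con 1 :+ con 0)))) :* x := (x :+ x) :+ (x :+ x)) refl

  -- The witness is 1/4, and `3δ < 3δ + δ = 4δ = 1`.
  quarter : ∃[ δ ] 3 · δ < 1# × ⟦ 4 ⟧ * δ ≈ 1#
  quarter with inverse (0<⟦suc⟧ 3)
  ... | δ , 0<δ , 4δ≈1 = δ , 3δ<1 , 4δ≈1
    where
    3δ<1 : 3 · δ < 1#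
    3δ<1 = begin-strict
      3 · δ              ≈⟨ ×-congʳ 3 (*-identityˡ δ) ⟨
      3 · (1# * δ)       ≈⟨ ×-assoc-* 3 1# δ ⟨
      ⟦ 3 ⟧ * δ          ≈⟨ +-identityʳ (⟦ 3 ⟧ * δ) ⟨
      ⟦ 3 ⟧ * δ + 0#     <⟨ +-monoʳ-< (⟦ 3 ⟧ * δ) 0<δ ⟩
      ⟦ 3 ⟧ * δ + δ      ≈⟨ +-comm (⟦ 3 ⟧ * δ) δ ⟩
      δ + ⟦ 3 ⟧ * δ      ≈⟨ +-congʳ (*-identityˡ δ) ⟨
      1# * δ + ⟦ 3 ⟧ * δ ≈⟨ distribʳ δ 1# ⟦ 3 ⟧ ⟨
      ⟦ 4 ⟧ * δ          ≈⟨ 4δ≈1 ⟩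
      1#                 ∎

  module _ {A : Set} (γ γ′ : A → Bool) where

    -- Adding `j` to one count, instead of subtracting the counts, keeps the comparison in the
    -- natural numbers and lets `⟦⟧-mono-≤` carry it to the field.
    verdict : ∀ {m} → ℕ → Vec A m → Bool
    verdict j ss = does (j ℕ.+ hits γ′ ss ℕ.≤? hits γ ss)

    difference : A → Carrier
    difference a = 𝟙 (γ a) - 𝟙 (γ′ a)

    module _ (τ : Carrier) where

      deviation : ∀ {m} → Vec A m → Carrier
      deviation = ∑ (λ a → difference a - τ)

      deviation-hits : ∀ {m} (ss : Vec A m) →
        deviation ss + (⟦ hits γ′ ss ⟧ + ⟦ m ⟧ * τ) ≈ ⟦ hits γ ss ⟧
      deviation-hits [] = trans (+-identityˡ _) (trans (+-identityˡ _) (zeroˡ τ))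
      deviation-hits {suc m} (a ∷ ss) = begin-equality
        (X + D) + (⟦ bit (γ′ a) ℕ.+ hits γ′ ss ⟧ + (1# + ⟦ m ⟧) * τ)
          ≈⟨ +-congˡ (+-congʳ (trans (⟦⟧-homo-+ (bit (γ′ a)) _) (+-congʳ (⟦bit⟧ (γ′ a))))) ⟩
        (X + D) + ((b′ + W) + (1# + ⟦ m ⟧) * τ)
          -- The solver knows no subtraction, so `X` is moved next to `τ`, and the two together next
          -- to `b′`; then `x+[y-x]≈y` cancels twice.
          ≈⟨ solve 6 (λ x d b w m t → (x :+ d) :+ ((b :+ w) :+ (con 1 :+ m) :* t)
                := (b :+ (t :+ x)) :+ (d :+ (w :+ m :* t))) refl X D b′ W ⟦ m ⟧ τ ⟩
        (b′ + (τ + X)) + (D + (W + ⟦ m ⟧ * τ))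
          ≈⟨ +-cong (trans (+-congˡ (x+[y-x]≈y τ (difference a))) (x+[y-x]≈y b′ (𝟙 (γ a)))) (deviation-hits ss) ⟩
        𝟙 (γ a) + ⟦ hits γ ss ⟧
          ≈⟨ +-congʳ (⟦bit⟧ (γ a)) ⟨
        ⟦ bit (γ a) ⟧ + ⟦ hits γ ss ⟧
          ≈⟨ ⟦⟧-homo-+ (bit (γ a)) _ ⟨
        ⟦ bit (γ a) ℕ.+ hits γ ss ⟧ ∎
        where
        X = difference a - τ
        D = deviation ss
        b′ = 𝟙 (γ′ a)
        W = ⟦ hits γ′ ss ⟧

      -- The mean `mτ` of the count difference is at least `2j`, so a difference below `j` falls
      -- short of it by at least `j`.
      missed : ∀ j {m} (ss : Vec A m) → ⟦ j ⟧ + ⟦ j ⟧ ≤ ⟦ m ⟧ * τ →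
               ¬ (j ℕ.+ hits γ′ ss ℕ.≤ hits γ ss) →
               ⟦ j ⟧ * ⟦ j ⟧ ≤ deviation ss * deviation ss
      missed j {m} ss 2j≤mτ few = square-mono-≤-neg (0≤⟦⟧ j) (+-cancelˡ-≤ (J + W) (begin
        (J + W) + (J + D)    ≈⟨ solve 3 (λ j w d → (j :+ w) :+ (j :+ d) := d :+ (w :+ (j :+ j))) refl J W D ⟩
        D + (W + (J + J))    ≤⟨ +-monoʳ-≤ D (+-monoʳ-≤ W 2j≤mτ) ⟩
        D + (W + ⟦ m ⟧ * τ)  ≈⟨ deviation-hits ss ⟩
        ⟦ hits γ ss ⟧        ≤⟨ ⟦⟧-mono-≤ (ℕ.<⇒≤ (ℕ.≰⇒> few)) ⟩
        ⟦ j ℕ.+ hits γ′ ss ⟧ ≈⟨ ⟦⟧-homo-+ j (hits γ′ ss) ⟩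
        J + W                ≈⟨ +-identityʳ (J + W) ⟨
        (J + W) + 0#         ∎))
        where
        J = ⟦ j ⟧
        W = ⟦ hits γ′ ss ⟧
        D = deviation ss

      -- With mean zero the deviation is the count difference itself, which has reached the
      -- threshold `j`.
      spurious : ∀ j {m} (ss : Vec A m) → τ ≈ 0# →
                 j ℕ.+ hits γ′ ss ℕ.≤ hits γ ss →
                 ⟦ j ⟧ * ⟦ j ⟧ ≤ deviation ss * deviation ss
      spurious j {m} ss τ≈0 many = square-mono-≤ (0≤⟦⟧ j) (+-cancelˡ-≤ W (begin
        W + J                ≈⟨ +-comm W J ⟩
        J + W                ≈⟨ ⟦⟧-homo-+ j (hits γ′ ss) ⟨
        ⟦ j ℕ.+ hits γ′ ss ⟧ ≤⟨ ⟦⟧-mono-≤ many ⟩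
        ⟦ hits γ ss ⟧        ≈⟨ deviation-hits ss ⟨
        D + (W + ⟦ m ⟧ * τ)  ≈⟨ +-congˡ (+-congˡ (trans (*-congˡ τ≈0) (zeroʳ ⟦ m ⟧))) ⟩
        D + (W + 0#)         ≈⟨ solve 2 (λ d w → d :+ (w :+ con 0) := w :+ d) refl D W ⟩
        W + D                ∎))
        where
        J = ⟦ j ⟧
        W = ⟦ hits γ′ ss ⟧
        D = deviation ss

      -- A wrong verdict forces a deviation of size at least `J`, so `J² ≤ J² * 𝟙 (correct ss) + D²`
      -- pointwise. Taking expectations gives `J² ≤ J² * Pr + m`, where `m = R²` is a quarter of
      -- `J² = (2R)²`. As `≤` is a negation, it is `Pr < 1 - δ` that gets refuted. Guarding the
      -- hypotheses on `τ` by `z` lets one argument cover equal and unequal inputs.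
      verdict-reliable : ∀ {E} → IsExpectation E → ∀ {δ} → ⟦ 4 ⟧ * δ ≈ 1# → E difference ≈ τ →
        ∀ z r → (z ≡ true → ⟦ 4 ⟧ ≤ ⟦ suc r ⟧ * τ) → (z ≡ false → τ ≈ 0#) →
        1# - δ ≤ overVec E (suc r ℕ.* suc r) λ ss →
          𝟙 (does (verdict (suc r ℕ.+ suc r) ss Bool.≟ z))
      verdict-reliable {E} isE {δ} 4δ≈1 ET≈τ z r large small Pr<1-δ = <.irrefl refl (begin-strict
        J²                         ≈⟨ E-const isEᵐ J² ⟨
        Eᵐ (λ _ → J²)              ≤⟨ E-mono isEᵐ wrong⇒deviates ⟩
        Eᵐ (λ ss → J² * 𝟙 (correct ss) + deviation ss * deviation ss)
                                   ≈⟨ E-+ isEᵐ (λ ss → J² * 𝟙 (correct ss)) (λ ss → deviation ss * deviation ss) ⟩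
        Eᵐ (λ ss → J² * 𝟙 (correct ss)) + Eᵐ (λ ss → deviation ss * deviation ss)
                                   ≈⟨ +-congʳ (E-* isEᵐ J² (𝟙 ∘ correct)) ⟩
        J² * Pr + Eᵐ (λ ss → deviation ss * deviation ss)
                                   ≤⟨ +-monoʳ-≤ (J² * Pr) (second-moment-∑ isE (centred-mean isE ET≈τ)
                                        (centred-second-moment isE ET≈τ (λ a → [𝟙-𝟙]²≤1 (γ a) (γ′ a))) m) ⟩
        J² * Pr + ⟦ m ⟧            ≈⟨ +-comm (J² * Pr) ⟦ m ⟧ ⟩
        ⟦ m ⟧ + J² * Pr            <⟨ +-monoʳ-< ⟦ m ⟧ (*-monoˡ-< 0<J² Pr<1-δ) ⟩
        ⟦ m ⟧ + J² * (1# - δ)      ≈⟨ +-congʳ m≈J²δ ⟩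
        J² * δ + J² * (1# - δ)     ≈⟨ distribˡ J² δ (1# - δ) ⟨
        J² * (δ + (1# - δ))        ≈⟨ *-congˡ (x+[y-x]≈y δ 1#) ⟩
        J² * 1#                    ≈⟨ *-identityʳ J² ⟩
        J²                         ∎)
        where
        R = ⟦ suc r ⟧
        m = suc r ℕ.* suc r
        j = suc r ℕ.+ suc r
        J = ⟦ j ⟧
        J² = J * J
        Eᵐ = overVec E m
        isEᵐ = overVec-isExpectation isE m
        correct : Vec A m → Bool
        correct ss = does (verdict j ss Bool.≟ z)
        Pr = Eᵐ (𝟙 ∘ correct)

        0<J² : 0# < J²
        0<J² = *-pos (0<⟦suc⟧ (r ℕ.+ suc r)) (0<⟦suc⟧ (r ℕ.+ suc r))

        m≈J²δ : ⟦ m ⟧ ≈ J² * δ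
        m≈J²δ = begin-equality
          ⟦ m ⟧                  ≈⟨ ⟦⟧-homo-* (suc r) (suc r) ⟩
          R * R                  ≈⟨ *-identityʳ (R * R) ⟨
          R * R * 1#             ≈⟨ *-congˡ 4δ≈1 ⟨
          R * R * (⟦ 4 ⟧ * δ)    ≈⟨ *-congˡ (⟦4⟧* δ) ⟩
          R * R * ((δ + δ) + (δ + δ))
            ≈⟨ solve 2 (λ r d → r :* r :* ((d :+ d) :+ (d :+ d)) := (r :+ r) :* (r :+ r) :* d) refl R δ ⟩
          (R + R) * (R + R) * δ  ≈⟨ *-congʳ (*-cong (⟦⟧-homo-+ (suc r) (suc r)) (⟦⟧-homo-+ (suc r) (suc r))) ⟨
          J² * δ                 ∎

        2J≤mτ : z ≡ true → J + J ≤ ⟦ m ⟧ * τ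
        2J≤mτ z≡true = begin
          J + J                  ≈⟨ +-cong (⟦⟧-homo-+ (suc r) (suc r)) (⟦⟧-homo-+ (suc r) (suc r)) ⟩
          (R + R) + (R + R)      ≈⟨ ⟦4⟧* R ⟨
          ⟦ 4 ⟧ * R              ≈⟨ *-comm ⟦ 4 ⟧ R ⟩
          R * ⟦ 4 ⟧              ≤⟨ *-monoˡ-≤ (0≤⟦⟧ (suc r)) (large z≡true) ⟩
          R * (R * τ)            ≈⟨ *-assoc R R τ ⟨
          R * R * τ              ≈⟨ *-congʳ (⟦⟧-homo-* (suc r) (suc r)) ⟨
          ⟦ m ⟧ * τ              ∎

        wrong⇒deviates : ∀ ss → J² ≤ J² * 𝟙 (correct ss) + deviation ss * deviation ss
        -- The expected answer and the decision are passed as arguments so that matching on them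
        -- makes `correct` compute. The equation keeps `z′` tied to `z`, which guards the hypotheses
        -- on `τ`.
        wrong⇒deviates ss = go z ≡.refl (j ℕ.+ hits γ′ ss ℕ.≤? hits γ ss)
          where
          D² = deviation ss * deviation ss
          right : J² ≤ J² * 1# + D²
          right = ≤-trans (≤-reflexive (sym (*-identityʳ J²))) (x≤x+y (J² * 1#) (square-nonneg (deviation ss)))
          wrong : J² ≤ D² → J² ≤ J² * 0# + D²
          wrong J²≤D² = ≤-trans J²≤D² (≤-reflexive (sym (trans (+-congʳ (zeroʳ J²)) (+-identityˡ D²))))
          go : ∀ z′ → z′ ≡ z → (d : Dec (j ℕ.+ hits γ′ ss ℕ.≤ hits γ ss)) →
               J² ≤ J² * 𝟙 (does (does d Bool.≟ z′)) + D²
          go true  _  (yes _)    = right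
          go true  eq (no few)   = wrong (missed j ss (2J≤mτ (≡.sym eq)) few)
          go false eq (yes many) = wrong (spurious j ss (small (≡.sym eq)) many)
          go false _  (no _)     = right

-- The protocol for equality and its analysis.

module EqualityProtocol {c ℓ₁ ℓ₂ ℓ₃} (F : ArchimedeanOrderedField c ℓ₁ ℓ₂ ℓ₃) where

  open ArchimedeanOrderedField F hiding (sum; zero)
  open OrderedFieldProperties F
  open Expectations F
  open Correlation F
  open Testing F
  open SMPModel F
  open IsExpectation
  open ≤-Reasoning

  point : Distribution 1
  point = record
    { prob   = λ _ → 1#
    ; nonneg = λ _ → <⇒≤ 0<1
    ; total  = +-identityʳ 1#
    }

  module _ {p q} (f : Fin p → Bool) (g : Fin q → Bool) (r : ℕ) (n : ℕ) where

    -- Each round consumes a chunk of `size` samples. Only `size` grows with `n`, and it affects the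
    -- number of samples but not the message lengths.
    rounds size : ℕ
    rounds = suc r ℕ.* suc r
    size = suc (2 ^ n)

    -- Position zero of a chunk is the spare sample.

    slot : Vec Bool n → Fin size
    slot x = suc (index x)

    aliceBits : Vec Bool n → Vec (Fin p) (rounds ℕ.* size) → Vec Bool rounds
    aliceBits x us = tabulate λ i → f (lookup us (combine i (slot x)))

    bobBits : Vec Bool n → Vec (Fin q) (rounds ℕ.* size) → Vec (Bool × Bool) rounds
    bobBits y vs = tabulate λ i → at i (slot y) , at i zero
      where
      at : Fin rounds → Fin size → Bool
      at i k = g (lookup vs (combine i k))

    protocol : Protocol p q n
    protocol = record
      { samples = rounds ℕ.* size
      ; seedᴬ   = point
      ; seedᴮ   = point
      ; seedᴿ   = point
      ; alice   = λ x us _ → toList (aliceBits x us)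
      ; bob     = λ y vs _ → flatten (bobBits y vs)
      ; referee = λ as bs _ → does (suc r ℕ.+ suc r ℕ.+ crossed as bs ℕ.≤? direct as bs)
      }

    open Protocol protocol using (cost; bits; answer)

    bits≡ : ∀ x y s a b → bits x y s a b ≡ rounds ℕ.+ rounds ℕ.* 2
    bits≡ x y s a b = ≡.cong₂ ℕ._+_
      (Vec.length-toList (aliceBits x (Vec.map proj₁ s)))
      (length-flatten (bobBits y (Vec.map proj₂ s)))

    cost≤ : cost ℕ.≤ rounds ℕ.+ rounds ℕ.* 2
    cost≤ =
      overVec-lub maxBool-lub n λ x → overVec-lub maxBool-lub n λ y →
      overVec-lub maxPair-lub (rounds ℕ.* size) {λ s → maxFin λ a → maxFin λ b → bits x y s a b} λ s →
      maxFin-lub λ a → maxFin-lub λ b → ℕ.≤-reflexive (bits≡ x y s a b)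

    module _ (x y : Vec Bool n) where

      Chunk : Set
      Chunk = Vec (Fin p × Fin q) size

      -- One round as functions of its chunk: `γ` is the product ab and `γ′` the product ab′. They
      -- share Alice's bit, but by linearity the mean of their difference requires only their
      -- separate means.
      α β β′ γ γ′ : Chunk → Bool
      α s  = f (proj₁ (lookup s (slot x)))
      β s  = g (proj₂ (lookup s (slot y)))
      β′ s = g (proj₂ (lookup s zero))
      γ s  = α s ∧ β s
      γ′ s = α s ∧ β′ s

      -- Position `combine i k` of `concat ss` is entry `k` of chunk `i`. The messages are therefore
      -- maps over the chunks, and the referee's counts are `hits`.
      answer-concat : ∀ (ss : Vec Chunk rounds) a b c →
        answer x y (concat ss) a b c ≡ verdict γ γ′ (suc r ℕ.+ suc r) ss
      answer-concat ss a b c = ≡.trans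
        (≡.cong₂ (λ as bs → does (suc r ℕ.+ suc r ℕ.+ crossed as bs ℕ.≤? direct as bs))
          (≡.cong toList (tabulate≡map α ss λ i →
            ≡.cong f (lookup-map-concat proj₁ ss i (slot x))))
          (≡.cong flatten (tabulate≡map (λ s → β s , β′ s) ss λ i →
            ≡.cong₂ (λ v v′ → g v , g v′) (lookup-map-concat proj₂ ss i (slot y)) (lookup-map-concat proj₂ ss i zero))))
        (≡.cong₂ (λ w u → does (suc r ℕ.+ suc r ℕ.+ w ℕ.≤? u))
          (crossed-hits α β β′ ss) (direct-hits α β β′ ss))

      module _ (ρ : JointDistribution p q) where

        private
          E = 𝔼₂ ρ
          isE′ = 𝔼₂-isExpectation ρ
          Eˢ = overVec E size
          isEˢ = overVec-isExpectation isE′ size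

        Pr-answer : ∀ z → Pr[answer≡ z ] ρ protocol x y ≈
          overVec Eˢ rounds λ ss → 𝟙 (does (verdict γ γ′ (suc r ℕ.+ suc r) ss Bool.≟ z))
        Pr-answer z = begin-equality
          Pr[answer≡ z ] ρ protocol x y
            -- The protocol is deterministic, so the three expectations over private seeds are of
            -- constants.
            ≈⟨ E-cong (overVec-isExpectation isE′ (rounds ℕ.* size)) (λ s →
                 trans (𝔼-const point _) (trans (𝔼-const point _) (𝔼-const point (𝟙 (correct s))))) ⟩
          overVec E (rounds ℕ.* size) (λ s → 𝟙 (correct s))
            ≈⟨ overVec-concat isE′ rounds size (λ s → 𝟙 (correct s)) ⟩
          overVec Eˢ rounds (λ ss → 𝟙 (correct (concat ss)))
            ≈⟨ E-cong (overVec-isExpectation isEˢ rounds) {g = 𝟙 ∘ correct ∘ concat} {h = 𝟙 ∘ correct′} (λ ss →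
                 reflexive (≡.cong 𝟙 {x = correct (concat ss)} {y = correct′ ss}
                   (≡.cong (λ b → does (b Bool.≟ z)) (answer-concat ss zero zero zero)))) ⟩
          overVec Eˢ rounds (λ ss → 𝟙 (does (verdict γ γ′ (suc r ℕ.+ suc r) ss Bool.≟ z))) ∎
          where
          correct : Vec (Fin p × Fin q) (rounds ℕ.* size) → Bool
          correct s = does (answer x y s zero zero zero Bool.≟ z)
          correct′ : Vec Chunk rounds → Bool
          correct′ ss = does (verdict γ γ′ (suc r ℕ.+ suc r) ss Bool.≟ z)

        fg = E (𝟙ˡʳ ρ f g)
        f₀ = E (𝟙ˡ ρ f)
        g₀ = E (𝟙ʳ ρ g)

        independent : ∀ (i j : Fin size) → i ≢ j →
          Eˢ (λ s → 𝟙 (f (proj₁ (lookup s i)) ∧ g (proj₂ (lookup s j)))) ≈ f₀ * g₀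
        independent i j i≢j = trans
          (E-cong isEˢ λ s → 𝟙-∧ (f (proj₁ (lookup s i))) (g (proj₂ (lookup s j))))
          (overVec-lookup-independent isE′ i≢j (𝟙ˡ ρ f) (𝟙ʳ ρ g))

        -- Both tests in `γ` read the same sample, which gives the joint moment `fg`. In `γ′` Bob's
        -- test reads the spare sample at position zero, which is never a `slot`, and the moment
        -- factors.
        mean-equal : x ≡ y → Eˢ (difference γ γ′) ≈ fg - f₀ * g₀
        mean-equal ≡.refl = trans (E-- isEˢ (𝟙 ∘ γ) (𝟙 ∘ γ′)) (+-cong
          (trans (E-cong isEˢ λ s → 𝟙-∧ (α s) (β s)) (overVec-lookup isE′ (slot x) (𝟙ˡʳ ρ f g)))
          (-‿cong (independent (slot x) zero λ ())))

        -- Both `γ` and `γ′` now pair different positions, so their means are the same product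
        -- `f₀ * g₀`.
        mean-unequal : x ≢ y → Eˢ (difference γ γ′) ≈ 0#
        mean-unequal x≢y = begin-equality
          Eˢ (difference γ γ′)     ≈⟨ E-- isEˢ (𝟙 ∘ γ) (𝟙 ∘ γ′) ⟩
          Eˢ (𝟙 ∘ γ) - Eˢ (𝟙 ∘ γ′) ≈⟨ +-cong (independent (slot x) (slot y) (x≢y ∘ index-injective x y ∘ suc-injective))
                                             (-‿cong (independent (slot x) zero λ ())) ⟩
          f₀ * g₀ - f₀ * g₀        ≈⟨ -‿inverseʳ (f₀ * g₀) ⟩
          0#                       ∎

        reliable : ∀ {δ} → ⟦ 4 ⟧ * δ ≈ 1# → ⟦ 4 ⟧ ≤ ⟦ suc r ⟧ * (fg - f₀ * g₀) →
                   1# - δ ≤ Pr[answer≡ EQ n x y ] ρ protocol x y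
        -- `EQ` is computed by this same decision, so splitting on it also fixes the expected
        -- answer.
        reliable 4δ≈1 4≤rd with Vec.≡-dec Bool._≟_ x y
        ... | yes x≡y = ≤-trans
          (verdict-reliable γ γ′ _ isEˢ 4δ≈1 (mean-equal x≡y) true r (λ _ → 4≤rd) (λ ()))
          (≤-reflexive (sym (Pr-answer true)))
        ... | no x≢y = ≤-trans
          (verdict-reliable γ γ′ _ isEˢ 4δ≈1 (mean-unequal x≢y) false r (λ ()) (λ _ → refl))
          (≤-reflexive (sym (Pr-answer false)))

theorem1p5 : ∀ {c ℓ₁ ℓ₂ ℓ₃} (F : ArchimedeanOrderedField c ℓ₁ ℓ₂ ℓ₃) →
    let open SMPModel F in
    ∀ {p q : ℕ} (ρ : JointDistribution p q) → NotProduct ρ →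
    ∃[ C ] (∀ (n : ℕ) → SMP[ ρ , EQ n ]≤ C)
theorem1p5 F ρ notProduct =
  let open OrderedFieldProperties F
      open Testing F
      open Correlation F
      open EqualityProtocol F
      f , g , correlated = ∃-positivelyCorrelated ρ notProduct
      -- The covariance of the two tests depends on `ρ` alone, so `r` is fixed before `n` is
      -- introduced.
      r , 4≤rd = ∃-multiple (x<y⇒0<y-x correlated) ⟦ 4 ⟧
      δ , 3δ<1 , 4δ≈1 = quarter
  -- `rounds` has the same value for every `n`; it is taken at `0` because the constant must precede
  -- `n`. Each round costs one bit from Alice and two from Bob.
  in  rounds f g r 0 ℕ.+ rounds f g r 0 ℕ.* 2 , λ n →
      protocol f g r n ,
      (δ , 3δ<1 , λ x y → reliable f g r n x y ρ 4δ≈1 4≤rd) ,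
      cost≤ f g r n
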